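{- Let $n=p\,q^{\alpha}$ with $\alpha\ge 1$ an integer and $p,q$ distinct primes such that $q\not\equiv 1\pmod 3$. If $n$ divides $\sigma_3(n)$, then $n$ is an even perfect number different from $28$.
   Context: $\sigma_3(n)=\sum_{d\mid n} d^3$, the sum over the positive divisors of $n$. A positive integer $n$ is perfect if $\sigma_1(n)=\sum_{d\mid n}d=2n$. -}

module Defs where

open import Data.Nat using (ℕ; _+_; _*_; _^_)
open import Data.Nat.Divisibility using (_∣_; _∣?_)
open import Data.List using (List; map; filter; upTo)
open import Data.Nat.ListAction using (sum)
open import Relation.Binary.PropositionalEquality using (_≡_)

divisors : ℕ → List ℕ
divisors n = filter (_∣? n) (map (1 +_) (upTo n))

σ : ℕ → ℕ → ℕ
σ k n = sum (map (λ d → d ^ k) (divisors n))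

Perfect : ℕ → Set
Perfect n = σ 1 n ≡ 2 * n

module Submission where

open import Defs
open import Data.Empty using (⊥; ⊥-elim)
open import Data.List using (List; []; _∷_; [_]; map; _++_; upTo; _∷ʳ_)
open import Data.List.Membership.Propositional using (_∈_)
open import Data.List.Membership.Propositional.Properties
  using (∈-map⁺; ∈-map⁻; ∈-++⁺ˡ; ∈-++⁺ʳ; ∈-++⁻; ∈-upTo⁺; ∈-upTo⁻; ∈-filter⁺; ∈-filter⁻)
open import Data.List.Membership.Propositional.Properties.WithK using (unique∧set⇒bag)
open import Data.List.Properties using (map-++; map-∘; upTo-∷ʳ)
open import Data.List.Relation.Binary.BagAndSetEquality using (∼bag⇒↭)
open import Data.List.Relation.Binary.Permutation.Propositional using (_↭_)
open import Data.List.Relation.Binary.Permutation.Propositional.Properties using (map⁺)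
open import Data.List.Relation.Unary.Unique.Propositional using (Unique)
import Data.List.Relation.Unary.Unique.Propositional.Properties as Unique
open import Data.Nat
  using (ℕ; zero; suc; _+_; _*_; _^_; _∸_; _/_; _%_; _≤_; _<_; _≥_; z≤n; s≤s; s≤s⁻¹;
         NonZero; >-nonZero; ≢-nonZero⁻¹; nonTrivial⇒n>1)
open import Data.Nat.DivMod
  using (m≡m%n+[m/n]*n; m%n<n; m<n⇒m%n≡m; [m+kn]%n≡m%n; %-distribˡ-+; %-distribˡ-*)
open import Data.Nat.Divisibility
open import Data.Nat.Induction using (Acc; acc; <-wellFounded)
open import Data.Nat.ListAction using (sum)
open import Data.Nat.ListAction.Properties using (sum-++; sum-↭)
open import Data.Nat.Primality
  using (Prime; prime?; prime[2]; prime⇒nonZero; prime⇒nonTrivial; prime⇒irreducible; euclidsLemma)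
open import Data.Nat.Properties
open import Algebra.Properties.CommutativeSemigroup *-commutativeSemigroup
  using (interchange; x∙yz≈y∙xz; x∙yz≈xz∙y; xy∙z≈y∙xz)
open import Data.Nat.Tactic.RingSolver using (solve-∀)
open import Data.Product using (∃-syntax; _×_; _,_)
open import Data.Sum using (_⊎_; inj₁; inj₂; [_,_]′)
open import Function using (_∘_; id; case_of_)
open import Function.Bundles using (mk⇔)
open import Relation.Binary.Definitions using (tri<; tri≈; tri>)
open import Relation.Binary.PropositionalEquality
  using (_≡_; _≢_; refl; sym; trans; cong; cong₂; subst; module ≡-Reasoning)
open import Relation.Nullary using (¬_; yes; no; contradiction)
open import Relation.Nullary.Decidable using (from-no; from-yes)

-- Put S = 1 + q³ + ⋯ + q^{3α} and y = q^{α+1}, so that σ₃(n) = (1 + p³) S, p ∣ S and q^α ∣ 1 + p³.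
-- A number ≡ 2 (mod 3) never divides a value of Y² + Y + 1. Since 1 + p³ = (1 + p) ((p-1)² + (p-1) + 1),
-- this gives q^α ∣ p + 1 when q ≡ 2 (mod 3), and 3^{α-1} ∣ p + 1 with p ≡ 2 (mod 3) when q = 3.
-- From p ∣ S ∣ y³ - 1, either p ∣ y - 1 or p ∣ y² + y + 1.
-- Write p + 1 = k x with x = q^α (or 3^{α-1}). If p ∣ y - 1 then p ∣ q - k (or 9 - k), and by size p + 1 = y,
-- which makes n = 2^α (2^{α+1} - 1), up to a few small cases.
-- If p ∣ y² + y + 1, which forces q ≡ 2 (mod 3), then p and its cofactor are k x - 1 and s x - 1 with
-- k s = q² + c and q + k + s = c x for some c ≥ 1. As k + s ≤ k s + 1, this leaves for α ≥ 3 only q = 2, α = 3,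
-- p = 7, where 7 ∤ S = 585. For α = 2 it forces c = 1, impossible modulo 3, or q = 2. For α = 1 it says
-- p ∣ (q + k)² - 1, so k and q are small.
-- The case n = 28 is excluded because there p = 7 and S = 73.

-- Prime divisors, and the divisors of `m * q ^ α`.

prime⇒1< : ∀ {p} → Prime p → 1 < p
prime⇒1< {p} pp = nonTrivial⇒n>1 p {{prime⇒nonTrivial pp}}

prime∤1 : ∀ {p} → Prime p → p ∤ 1
prime∤1 pp p∣1 = <⇒≢ (prime⇒1< pp) (sym (∣1⇒≡1 p∣1))

prime∣prime⇒≡ : ∀ {p q} → Prime p → Prime q → p ∣ q → p ≡ q
prime∣prime⇒≡ pp pq p∣q with prime⇒irreducible pq p∣q
... | inj₁ refl = contradiction ∣-refl (prime∤1 pp)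
... | inj₂ p≡q  = p≡q

prime∣^⇒∣ : ∀ {p b} n → Prime p → p ∣ b ^ n → p ∣ b
prime∣^⇒∣         zero    pp p∣1 = contradiction p∣1 (prime∤1 pp)
prime∣^⇒∣ {b = b} (suc n) pp p∣b^n = [ id , prime∣^⇒∣ n pp ]′ (euclidsLemma b (b ^ n) pp p∣b^n)

∤⇒∣-cancel : ∀ {q d w} → Prime q → q ∤ d → d ∣ q * w → d ∣ w
∤⇒∣-cancel {q} {d} {w} pq q∤d (divides t qw≡td)
  with euclidsLemma t d pq (subst (q ∣_) qw≡td (m∣m*n w))
... | inj₂ q∣d = contradiction q∣d q∤d
... | inj₁ (divides s refl) = divides s (*-cancelˡ-≡ w (s * d) q {{prime⇒nonZero pq}} (trans qw≡td (xy∙z≈y∙xz s q d)))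

-- Induction on `α`: if `q ∣ d`, one factor `q` leaves both sides and is counted in `i`; otherwise
-- Euclid's lemma cancels it from the right side alone.
∣m*q^⇒ : ∀ {d q} m α → Prime q → d ∣ m * q ^ α →
         ∃[ e ] ∃[ i ] (i ≤ α × e ∣ m × d ≡ e * q ^ i)
∣m*q^⇒ {d} m zero pq d∣m =
  d , 0 , z≤n , subst (d ∣_) (*-identityʳ m) d∣m , sym (*-identityʳ d)
∣m*q^⇒ {d} {q} m (suc α) pq d∣ with q ∣? d
... | no q∤d
    with e , i , i≤α , e∣m , d≡ ← ∣m*q^⇒ m α pq (∤⇒∣-cancel pq q∤d (subst (d ∣_) (x∙yz≈y∙xz m q (q ^ α)) d∣))
    = e , i , m≤n⇒m≤1+n i≤α , e∣m , d≡
... | yes (divides c refl)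
    with e , i , i≤α , e∣m , refl ← ∣m*q^⇒ {c} m α pq
      (*-cancelʳ-∣ q {{prime⇒nonZero pq}} (subst (c * q ∣_) (x∙yz≈xz∙y m q (q ^ α)) d∣))
    = e , suc i , s≤s i≤α , e∣m , trans (*-assoc e (q ^ i) q) (cong (e *_) (*-comm (q ^ i) q))

-- Geometric sums and powers.

geo : ℕ → ℕ → ℕ
geo b zero    = 1
geo b (suc a) = geo b a + b ^ suc a

sum-pow : ∀ b a → sum (map (b ^_) (upTo (suc a))) ≡ geo b a
sum-pow b zero    = refl
sum-pow b (suc a) = begin
  sum (map (b ^_) (upTo (suc (suc a))))          ≡⟨ cong (sum ∘ map (b ^_)) (upTo-∷ʳ (suc a)) ⟨
  sum (map (b ^_) (upTo (suc a) ∷ʳ suc a))       ≡⟨ cong sum (map-++ (b ^_) (upTo (suc a)) [ suc a ]) ⟩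
  sum (map (b ^_) (upTo (suc a)) ++ [ b ^ suc a ]) ≡⟨ sum-++ (map (b ^_) (upTo (suc a))) [ b ^ suc a ] ⟩
  sum (map (b ^_) (upTo (suc a))) + (b ^ suc a + 0) ≡⟨ cong₂ _+_ (sum-pow b a) (+-identityʳ (b ^ suc a)) ⟩
  geo b a + b ^ suc a                            ∎
  where open ≡-Reasoning

-- The telescoping of (b - 1)(1 + ⋯ + b^a), with both subtractions moved across to stay in ℕ.
geo-telescope : ∀ b a → geo b a * b + 1 ≡ geo b a + b ^ suc a
geo-telescope b zero    = base b
  where
  base : ∀ b → 1 * b + 1 ≡ 1 + b * 1
  base = solve-∀
geo-telescope b (suc a) = begin
  (geo b a + b ^ suc a) * b + 1         ≡⟨ step (geo b a) (b ^ suc a) b ⟩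
  geo b a * b + 1 + b * b ^ suc a       ≡⟨ cong (_+ b * b ^ suc a) (geo-telescope b a) ⟩
  geo b a + b ^ suc a + b * b ^ suc a   ∎
  where
  open ≡-Reasoning
  step : ∀ g z b → (g + z) * b + 1 ≡ g * b + 1 + b * z
  step = solve-∀

-- All terms after the first are multiples of `b`, so the sum is ≡ 1 modulo `q`.
∤geo : ∀ {q b} a → Prime q → q ∣ b → q ∤ geo b a
∤geo zero pq q∣b q∣1 = prime∤1 pq q∣1
∤geo {q} {b} (suc a) pq q∣b q∣g =
  ∤geo a pq q∣b (∣m+n∣m⇒∣n (subst (q ∣_) (+-comm (geo b a) (b ^ suc a)) q∣g) (∣m⇒∣m*n (b ^ a) q∣b))

^-distribʳ-* : ∀ m n k → (m * n) ^ k ≡ m ^ k * n ^ k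
^-distribʳ-* m n zero    = refl
^-distribʳ-* m n (suc k) = trans (cong (m * n *_) (^-distribʳ-* m n k)) (interchange m n (m ^ k) (n ^ k))

^-injectiveʳ : ∀ {q i j} → 1 < q → q ^ i ≡ q ^ j → i ≡ j
^-injectiveʳ {q} {i} {j} 1<q eq with <-cmp i j
... | tri< i<j _ _ = contradiction eq (<⇒≢ (^-monoʳ-< q 1<q i<j))
... | tri≈ _ i≡j _ = i≡j
... | tri> _ _ j<i = contradiction (sym eq) (<⇒≢ (^-monoʳ-< q 1<q j<i))

sum-map-cong : ∀ {f g : ℕ → ℕ} → (∀ x → f x ≡ g x) → ∀ xs → sum (map f xs) ≡ sum (map g xs)
sum-map-cong f≗g []       = refl
sum-map-cong f≗g (x ∷ xs) = cong₂ _+_ (f≗g x) (sum-map-cong f≗g xs)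

sum-map-* : ∀ c (f : ℕ → ℕ) xs → sum (map (λ x → c * f x) xs) ≡ c * sum (map f xs)
sum-map-* c f []       = sym (*-zeroʳ c)
sum-map-* c f (x ∷ xs) = trans (cong (c * f x +_) (sum-map-* c f xs)) (sym (*-distribˡ-+ c (f x) _))

-- The divisors of p q^α and their power sums.

module _ {p q : ℕ} (pp : Prime p) (pq : Prime q) (p≢q : p ≢ q) (α : ℕ) where

  private
    instance
      p≢0 = prime⇒nonZero pp
      q≢0 = prime⇒nonZero pq

    n = p * q ^ α

    instance
      q^α≢0 = m^n≢0 q α
      n≢0 = m*n≢0 p (q ^ α)

    exps : List ℕ
    exps = upTo (suc α)

    divs : List ℕ
    divs = map (q ^_) exps ++ map (λ i → p * q ^ i) exps

  divs-unique : Unique divs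
  divs-unique = Unique.++⁺
    (Unique.map⁺ (^-injectiveʳ (prime⇒1< pq)) (Unique.upTo⁺ (suc α)))
    (Unique.map⁺ (λ eq → ^-injectiveʳ (prime⇒1< pq) (*-cancelˡ-≡ _ _ p eq)) (Unique.upTo⁺ (suc α)))
    λ (x∈ , x∈′) → disjoint (∈-map⁻ (q ^_) x∈) (∈-map⁻ (λ i → p * q ^ i) x∈′)
    where
    -- The second half consists of multiples of `p`, which divides no power of the other prime `q`.
    disjoint : ∀ {x} → ∃[ i ] (i ∈ exps × x ≡ q ^ i) → ¬ (∃[ j ] (j ∈ exps × x ≡ p * q ^ j))
    disjoint (i , _ , refl) (j , _ , eq) =
      p≢q (prime∣prime⇒≡ pp pq (prime∣^⇒∣ i pp (subst (p ∣_) (sym eq) (m∣m*n (q ^ j)))))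

  divisors-unique : Unique (divisors n)
  divisors-unique = Unique.filter⁺ (_∣? n) (Unique.map⁺ suc-injective (Unique.upTo⁺ n))

  ∣⇒∈divs : ∀ {d} → d ∣ n → d ∈ divs
  ∣⇒∈divs d∣n with ∣m*q^⇒ p α pq d∣n
  ... | e , i , i≤α , e∣p , refl with prime⇒irreducible pp e∣p
  ...   | inj₁ refl = ∈-++⁺ˡ (subst (_∈ map (q ^_) exps) (sym (*-identityˡ (q ^ i)))
                        (∈-map⁺ (q ^_) {x = i} (∈-upTo⁺ (s≤s i≤α))))
  ...   | inj₂ refl = ∈-++⁺ʳ (map (q ^_) exps) (∈-map⁺ (λ i → p * q ^ i) (∈-upTo⁺ (s≤s i≤α)))

  ^∣^ : ∀ {i j} → i ≤ j → q ^ i ∣ q ^ j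
  ^∣^ {i} {j} i≤j = divides (q ^ (j ∸ i))
    (trans (cong (q ^_) (sym (m∸n+n≡m i≤j))) (^-distribˡ-+-* q (j ∸ i) i))

  ∈divs⇒∣ : ∀ {d} → d ∈ divs → d ∣ n
  ∈divs⇒∣ d∈ with ∈-++⁻ (map (q ^_) exps) d∈
  ... | inj₁ d∈ˡ with i , i∈ , refl ← ∈-map⁻ (q ^_) {xs = exps} d∈ˡ =
        ∣n⇒∣m*n p (^∣^ {i} {α} (s≤s⁻¹ (∈-upTo⁻ i∈)))
  ... | inj₂ d∈ʳ with i , i∈ , refl ← ∈-map⁻ (λ i → p * q ^ i) {xs = exps} d∈ʳ =
        *-monoʳ-∣ p (^∣^ {i} {α} (s≤s⁻¹ (∈-upTo⁻ i∈)))

  ∣⇒∈divisors : ∀ {d} → d ∣ n → d ∈ divisors n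
  ∣⇒∈divisors {zero}  0∣n = contradiction (0∣⇒≡0 0∣n) (≢-nonZero⁻¹ n)
  ∣⇒∈divisors {suc d} d∣n =
    ∈-filter⁺ (_∣? n) (∈-map⁺ suc (∈-upTo⁺ (∣⇒≤ d∣n))) d∣n

  -- Duplicate-free lists with the same members are permutations of each other; this carries sums
  -- over to the explicit list.
  divisors↭ : divisors n ↭ divs
  divisors↭ = ∼bag⇒↭ (unique∧set⇒bag divisors-unique divs-unique
    (mk⇔ divisors⇒divs (λ d∈ → ∣⇒∈divisors (∈divs⇒∣ d∈))))
    where
    divisors⇒divs : ∀ {d} → d ∈ divisors n → d ∈ divs
    divisors⇒divs d∈ with _ , d∣n ← ∈-filter⁻ (_∣? n) {xs = map suc (upTo n)} d∈ = ∣⇒∈divs d∣n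

  -- Divisors q^i give the geometric sum in q^k, and the divisors p q^i give p^k times it. The
  -- divisibility hypothesis takes `k = 3`, perfection `k = 1`.
  σ-p*q^ : ∀ k → σ k n ≡ (1 + p ^ k) * geo (q ^ k) α
  σ-p*q^ k = begin
    sum (map (_^ k) (divisors n))    ≡⟨ sum-↭ (map⁺ (_^ k) divisors↭) ⟩
    sum (map (_^ k) divs)            ≡⟨ cong sum (map-++ (_^ k) (map (q ^_) exps) _) ⟩
    sum (map (_^ k) (map (q ^_) exps) ++ map (_^ k) (map (λ i → p * q ^ i) exps))
                                     ≡⟨ sum-++ (map (_^ k) (map (q ^_) exps)) _ ⟩
    sum (map (_^ k) (map (q ^_) exps)) + sum (map (_^ k) (map (λ i → p * q ^ i) exps))
      ≡⟨ cong₂ (λ xs ys → sum xs + sum ys)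
           (map-∘ {g = _^ k} {f = q ^_} exps) (map-∘ {g = _^ k} {f = λ i → p * q ^ i} exps) ⟨
    sum (map (λ i → (q ^ i) ^ k) exps) + sum (map (λ i → (p * q ^ i) ^ k) exps)
      ≡⟨ cong₂ _+_ (sum-map-cong comm-exp exps)
           (sum-map-cong (λ i → trans (^-distribʳ-* p (q ^ i) k) (cong (p ^ k *_) (comm-exp i))) exps) ⟩
    S + sum (map (λ i → p ^ k * (q ^ k) ^ i) exps) ≡⟨ cong (S +_) (sum-map-* (p ^ k) ((q ^ k) ^_) exps) ⟩
    S + p ^ k * S                     ≡⟨⟩
    (1 + p ^ k) * S                   ≡⟨ cong ((1 + p ^ k) *_) (sum-pow (q ^ k) α) ⟩
    (1 + p ^ k) * geo (q ^ k) α       ∎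
    where
    open ≡-Reasoning
    S = sum (map ((q ^ k) ^_) exps)
    comm-exp : ∀ i → (q ^ i) ^ k ≡ (q ^ k) ^ i
    comm-exp i = trans (^-*-assoc q i k) (trans (cong (q ^_) (*-comm i k)) (sym (^-*-assoc q k i)))

-- Residues modulo 3 and the values of y² + y + 1.

%3-cases : ∀ n → n % 3 ≡ 0 ⊎ n % 3 ≡ 1 ⊎ n % 3 ≡ 2
%3-cases n with n % 3 | m%n<n n 3
... | 0 | _ = inj₁ refl
... | 1 | _ = inj₂ (inj₁ refl)
... | 2 | _ = inj₂ (inj₂ refl)
... | suc (suc (suc _)) | s≤s (s≤s (s≤s ()))

*-%3 : ∀ a b {i j} → a % 3 ≡ i → b % 3 ≡ j → (a * b) % 3 ≡ (i * j) % 3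
*-%3 a b refl refl = %-distribˡ-* a b 3

+-%3 : ∀ a b {i j} → a % 3 ≡ i → b % 3 ≡ j → (a + b) % 3 ≡ (i + j) % 3
+-%3 a b refl refl = %-distribˡ-+ a b 3

%3≡1⇒ : ∀ n → n % 3 ≡ 1 → n ≡ 1 + n / 3 * 3
%3≡1⇒ n eq = trans (m≡m%n+[m/n]*n n 3) (cong (_+ n / 3 * 3) eq)

-- The third cyclotomic polynomial: a factor of y³ - 1 and, taken at p - 1, of p³ + 1.
quad : ℕ → ℕ
quad y = y * y + y + 1

quad-%3 : ∀ y {i} → y % 3 ≡ i → quad y % 3 ≡ quad i % 3
quad-%3 y {i} refl = begin
  quad y % 3                                 ≡⟨ +-%3 (y * y + y) 1 (+-%3 (y * y) y (*-%3 y y refl refl) refl) refl ⟩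
  (((i * i) % 3 + i) % 3 + 1) % 3            ≡⟨ +-%3 (i * i + i) 1 (trans (+-%3 (i * i) i refl i%3) refl) refl ⟨
  quad i % 3                                 ∎
  where
  open ≡-Reasoning
  i%3 : i % 3 ≡ i
  i%3 = m<n⇒m%n≡m (m%n<n y 3)

-- So for y ≡ 1 (mod 3) the factor 3 occurs exactly once, and the remaining factor is again ≡ 1.
quad-1+3i : ∀ i → quad (1 + i * 3) ≡ (1 + (i + i * i) * 3) * 3
quad-1+3i = expand
  where
  expand : ∀ i → (1 + i * 3) * (1 + i * 3) + (1 + i * 3) + 1 ≡ (1 + (i + i * i) * 3) * 3
  expand = solve-∀

quad-+-* : ∀ z b N → quad (z + b * N) ≡ N * (b * (2 * z + b * N + 1)) + quad z
quad-+-* = expand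
  where
  expand : ∀ z b N → (z + b * N) * (z + b * N) + (z + b * N) + 1 ≡ N * (b * (2 * z + b * N + 1)) + (z * z + z + 1)
  expand = solve-∀

-- With N = 2 + n, this makes the cofactor of N in `quad z` smaller than N, which drives the
-- descent.
quad-< : ∀ {z n} → z ≤ 1 + n → quad z < (2 + n) * (2 + n)
quad-< {z} {n} z≤ = begin-strict
  quad z                  ≤⟨ +-monoˡ-≤ 1 (+-mono-≤ (*-mono-≤ z≤ z≤) z≤) ⟩
  quad (1 + n)            <⟨ m<m+n (quad (1 + n)) (s≤s z≤n) ⟩
  quad (1 + n) + (1 + n)  ≡⟨ expand n ⟩
  (2 + n) * (2 + n)       ∎
  where
  open ≤-Reasoning
  expand : ∀ n → (1 + n) * (1 + n) + (1 + n) + 1 + (1 + n) ≡ (2 + n) * (2 + n)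
  expand = solve-∀

*2%3≡1⇒ : ∀ a {N} → N % 3 ≡ 2 → (a * N) % 3 ≡ 1 → a % 3 ≡ 2
*2%3≡1⇒ a {N} N≡2 aN≡1 with %3-cases a
... | inj₁ a≡0        = case trans (sym aN≡1) (*-%3 a N a≡0 N≡2) of λ ()
... | inj₂ (inj₁ a≡1) = case trans (sym aN≡1) (*-%3 a N a≡1 N≡2) of λ ()
... | inj₂ (inj₂ a≡2) = a≡2

*2%3≡0⇒ : ∀ a {N} → N % 3 ≡ 2 → (a * N) % 3 ≡ 0 → a % 3 ≡ 0
*2%3≡0⇒ a {N} N≡2 aN≡0 with %3-cases a
... | inj₁ a≡0        = a≡0
... | inj₂ (inj₁ a≡1) = case trans (sym aN≡0) (*-%3 a N a≡1 N≡2) of λ ()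
... | inj₂ (inj₂ a≡2) = case trans (sym aN≡0) (*-%3 a N a≡2 N≡2) of λ ()

-- Descent: after reducing y modulo N, the cofactor of N in y² + y + 1, divided by 3 if possible,
-- is again ≡ 2 (mod 3), and it is smaller than N.
≡2mod3⇒∤quad : ∀ N y → N % 3 ≡ 2 → N ∤ quad y
≡2mod3⇒∤quad M y₀ = go M y₀ (<-wellFounded M)
  where
  reduced : ∀ n z → Acc _<_ (2 + n) → (2 + n) % 3 ≡ 2 → z ≤ 1 + n → 2 + n ∤ quad z
  go : ∀ N y → Acc _<_ N → N % 3 ≡ 2 → N ∤ quad y
  go N@(suc (suc n)) y rec N≡2 N∣ =
    reduced n (y % N) rec N≡2 (s≤s⁻¹ (m%n<n y N))
      (∣m+n∣m⇒∣n
        (subst (N ∣_) (trans (cong quad (m≡m%n+[m/n]*n y N)) (quad-+-* (y % N) (y / N) N)) N∣)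
        (m∣m*n (y / N * (2 * (y % N) + y / N * N + 1))))
  reduced n z (acc rec) N≡2 z≤ (divides m eq) = descend (%3-cases z)
    where
    N = 2 + n
    m<N : m < N
    m<N = *-cancelʳ-< N m N (subst (_< N * N) eq (quad-< z≤))
    m∣ : m ∣ quad z
    m∣ = divides N (trans eq (*-comm m N))
    -- If m N ≡ 1 with N ≡ 2, then m ≡ 2, so the smaller `m` can replace `N`.
    unless : (quad z) % 3 ≢ 1
    unless ≡1 = go m z (rec m<N) (*2%3≡1⇒ m N≡2 (trans (cong (_% 3) (sym eq)) ≡1)) m∣
    descend : ¬ (z % 3 ≡ 0 ⊎ z % 3 ≡ 1 ⊎ z % 3 ≡ 2)
    descend (inj₁ z≡0)        = unless (quad-%3 z z≡0)
    descend (inj₂ (inj₂ z≡2)) = unless (quad-%3 z z≡2)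
    -- Here `quad z` is 3 times a number ≡ 1, so m = 3a with a N ≡ 1, and `a` replaces `N`.
    descend (inj₂ (inj₁ z≡1)) with m%n≡0⇒n∣m m 3 (*2%3≡0⇒ m N≡2 (trans (cong (_% 3) (sym eq)) (quad-%3 z z≡1)))
    ... | divides a refl = go a z (rec (≤-<-trans (m≤m*n a 3) m<N)) (*2%3≡1⇒ a N≡2 aN≡1) (∣-trans (m∣m*n 3) m∣)
      where
      i = z / 3
      aN : a * N ≡ 1 + (i + i * i) * 3
      aN = *-cancelʳ-≡ (a * N) (1 + (i + i * i) * 3) 3 (begin
        a * N * 3                  ≡⟨ *-assoc a N 3 ⟩
        a * (N * 3)                ≡⟨ cong (a *_) (*-comm N 3) ⟩
        a * (3 * N)                ≡⟨ *-assoc a 3 N ⟨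
        a * 3 * N                  ≡⟨ eq ⟨
        quad z                     ≡⟨ cong quad (%3≡1⇒ z z≡1) ⟩
        quad (1 + i * 3)           ≡⟨ quad-1+3i i ⟩
        (1 + (i + i * i) * 3) * 3  ∎)
        where open ≡-Reasoning
      aN≡1 : (a * N) % 3 ≡ 1
      aN≡1 = trans (cong (_% 3) aN) ([m+kn]%n≡m%n 1 (i + i * i) 3)

-- Prime powers dividing products, and the shapes of quotients.

∤⇒^∣-cancel : ∀ {q w} α m → Prime q → q ∤ w → q ^ α ∣ m * w → q ^ α ∣ m
∤⇒^∣-cancel zero m pq q∤w _ = 1∣ m
∤⇒^∣-cancel {q} {w} (suc α) m pq q∤w ∣mw with euclidsLemma m w pq (∣-trans (m∣m*n (q ^ α)) ∣mw)
... | inj₂ q∣w = contradiction q∣w q∤w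
... | inj₁ (divides m′ refl) = subst (q * q ^ α ∣_) (*-comm q m′)
  (*-monoʳ-∣ q (∤⇒^∣-cancel α m′ pq q∤w (*-cancelˡ-∣ q {{prime⇒nonZero pq}}
    (subst (q * q ^ α ∣_) (trans (cong (_* w) (*-comm m′ q)) (*-assoc q m′ w)) ∣mw))))

2∣n⊎2∣1+n : ∀ n → 2 ∣ n ⊎ 2 ∣ suc n
2∣n⊎2∣1+n zero    = inj₁ (2 ∣0)
2∣n⊎2∣1+n (suc n) with 2∣n⊎2∣1+n n
... | inj₁ 2∣n  = inj₂ (∣m∣n⇒∣m+n ∣-refl 2∣n)
... | inj₂ 2∣1+n = inj₁ 2∣1+n

consecutive-primes : ∀ {p} → Prime p → Prime (suc p) → p ≡ 2
consecutive-primes {p} pp pq with 2∣n⊎2∣1+n p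
... | inj₁ 2∣p = sym (prime∣prime⇒≡ prime[2] pp 2∣p)
... | inj₂ 2∣q with refl ← prime∣prime⇒≡ prime[2] pq 2∣q = contradiction ∣-refl (prime∤1 pp)

-- Modulo p, k x ≡ 1 ≡ Q x, hence Q ≡ k; the sizes make Q ≥ k.
quotient-shape : ∀ {p k x Q t} .{{_ : NonZero x}} → 1 + p ≡ k * x → Q * x ≡ 1 + p * suc t →
                 ∃[ s ] Q ≡ k + s * p
quotient-shape {p} {k} {x} {Q} {t} p+1 Qx = finish (∣m+n∣m⇒∣n x∣Qx+t (n∣m*n Q))
  where
  -- Adding `t` completes the product (1 + p)(1 + t), a multiple of `x`; hence `x ∣ t`.
  Qx+t : Q * x + t ≡ k * x * suc t
  Qx+t = begin
    Q * x + t               ≡⟨ cong (_+ t) Qx ⟩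
    1 + p * (1 + t) + t     ≡⟨ expand p t ⟩
    (1 + p) * (1 + t)       ≡⟨ cong (_* suc t) p+1 ⟩
    k * x * suc t           ∎
    where
    open ≡-Reasoning
    expand : ∀ p t → 1 + p * (1 + t) + t ≡ (1 + p) * (1 + t)
    expand = solve-∀
  x∣Qx+t : x ∣ Q * x + t
  x∣Qx+t = subst (x ∣_) (sym Qx+t) (∣m⇒∣m*n (suc t) (n∣m*n k))
  finish : x ∣ t → ∃[ s ] Q ≡ k + s * p
  finish (divides s refl) = s , +-cancelˡ-≡ s Q (k + s * p) (*-cancelʳ-≡ (s + Q) (s + (k + s * p)) x (begin
    (s + Q) * x                      ≡⟨ *-distribʳ-+ x s Q ⟩
    s * x + Q * x                    ≡⟨ +-comm (s * x) (Q * x) ⟩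
    Q * x + s * x                    ≡⟨ Qx+t ⟩
    k * x * (1 + s * x)              ≡⟨ expand₁ k x s ⟩
    (k + s * (k * x)) * x            ≡⟨ cong (λ a → (k + s * a) * x) p+1 ⟨
    (k + s * (1 + p)) * x            ≡⟨ expand₂ k s p x ⟩
    (s + (k + s * p)) * x            ∎))
    where
    open ≡-Reasoning
    expand₁ : ∀ k x s → k * x * (1 + s * x) ≡ (k + s * (k * x)) * x
    expand₁ = solve-∀
    expand₂ : ∀ k s p x → (k + s * (1 + p)) * x ≡ (s + (k + s * p)) * x
    expand₂ = solve-∀

-- Modulo `x`, the value of `quad` is 1 and p ≡ -1, so r = s x - 1. Expanding (k x - 1)(s x - 1) and
-- dividing by `x` gives k s x = q² x + q + k + s; hence `x` divides q + k + s, with quotient `c`.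
cofactor-shape : ∀ {p r k q x} .{{_ : NonZero x}} → 1 + p ≡ k * x → quad (q * x) ≡ r * p →
                 ∃[ s ] ∃[ c ] (q + k + s ≡ c * x × k * s ≡ q * q + c)
cofactor-shape {p} {r} {k} {q} {x} p+1 eq = step₁ (∣m+n∣m⇒∣n x∣sum (∣m⇒∣m*n (q * x + 1) (n∣m*n q)))
  where
  open ≡-Reasoning
  sum-eq : q * x * (q * x + 1) + (1 + r) ≡ r * k * x
  sum-eq = begin
    q * x * (q * x + 1) + (1 + r)   ≡⟨ expand (q * x) r ⟩
    q * x * (q * x) + q * x + 1 + r ≡⟨ cong (_+ r) eq ⟩
    r * p + r                       ≡⟨ expand′ r p ⟩
    r * (1 + p)                     ≡⟨ cong (r *_) p+1 ⟩
    r * (k * x)                     ≡⟨ *-assoc r k x ⟨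
    r * k * x                       ∎
    where
    expand : ∀ y r → y * (y + 1) + (1 + r) ≡ y * y + y + 1 + r
    expand = solve-∀
    expand′ : ∀ r p → r * p + r ≡ r * (1 + p)
    expand′ = solve-∀
  x∣sum : x ∣ q * x * (q * x + 1) + (1 + r)
  x∣sum = subst (x ∣_) (sym sum-eq) (n∣m*n (r * k))
  step₁ : x ∣ 1 + r → ∃[ s ] ∃[ c ] (q + k + s ≡ c * x × k * s ≡ q * q + c)
  step₁ (divides s r+1) = step₂ (∣m+n∣m⇒∣n (subst (x ∣_) main (n∣m*n (k * s))) (n∣m*n (q * q)))
    where
    main : k * s * x ≡ q * q * x + (q + k + s)
    main = *-cancelʳ-≡ (k * s * x) (q * q * x + (q + k + s)) x (+-cancelˡ-≡ 1 _ _ (begin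
      1 + k * s * x * x                           ≡⟨ expand₁ k s x ⟩
      1 + (k * x) * (s * x)                       ≡⟨ cong₂ (λ a b → 1 + a * b) p+1 r+1 ⟨
      1 + (1 + p) * (1 + r)                       ≡⟨ expand₂ p r ⟩
      r * p + (1 + p) + (1 + r)                   ≡⟨ cong₂ (λ a b → a + b + (1 + r)) (sym eq) p+1 ⟩
      quad (q * x) + k * x + (1 + r)              ≡⟨ cong (quad (q * x) + k * x +_) r+1 ⟩
      quad (q * x) + k * x + s * x                ≡⟨ expand₃ q k s x ⟩
      1 + (q * q * x + (q + k + s)) * x           ∎))
      where
      expand₁ : ∀ k s x → 1 + k * s * x * x ≡ 1 + (k * x) * (s * x)
      expand₁ = solve-∀
      expand₂ : ∀ p r → 1 + (1 + p) * (1 + r) ≡ r * p + (1 + p) + (1 + r)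
      expand₂ = solve-∀
      expand₃ : ∀ q k s x → q * x * (q * x) + q * x + 1 + k * x + s * x ≡ 1 + (q * q * x + (q + k + s)) * x
      expand₃ = solve-∀
    step₂ : x ∣ q + k + s → ∃[ s ] ∃[ c ] (q + k + s ≡ c * x × k * s ≡ q * q + c)
    step₂ (divides c qks) = s , c , qks , *-cancelʳ-≡ (k * s) (q * q + c) x
      (trans main (trans (cong (q * q * x +_) qks) (sym (*-distribʳ-+ x (q * q) c))))

-- Factoring 1 + p³ and q^(3α+3) - 1.

1+n³ : ∀ v → 1 + suc v ^ 3 ≡ (1 + suc v) * quad v
1+n³ = expand
  where
  expand : ∀ v → 1 + (1 + v) * ((1 + v) * ((1 + v) * 1)) ≡ (1 + (1 + v)) * (v * v + v + 1)
  expand = solve-∀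

-- For y = q^(α+1), telescoping gives G (q³ - 1) = y³ - 1 = (y - 1)(y² + y + 1), and the prime `p`
-- divides one of the last two factors.
∣geo³⇒ : ∀ {p q} α → Prime p → 1 < q → p ∣ geo (q ^ 3) α →
         (∃[ t ] q ^ suc α ≡ 1 + p * suc t) ⊎ (∃[ r ] quad (q ^ suc α) ≡ r * p)
∣geo³⇒ {p} {q} α pp 1<q p∣G = split (q ^ suc α) (q ^ 3) 1<y (m^n>0 q 3) (begin
    G * q ^ 3 + 1              ≡⟨ geo-telescope (q ^ 3) α ⟩
    G + (q ^ 3) ^ suc α        ≡⟨ cong (G +_) (^-*-assoc q 3 (suc α)) ⟩
    G + q ^ (3 * suc α)        ≡⟨ cong (λ e → G + q ^ e) (*-comm 3 (suc α)) ⟩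
    G + q ^ (suc α * 3)        ≡⟨ cong (G +_) (^-*-assoc q (suc α) 3) ⟨
    G + (q ^ suc α) ^ 3        ∎)
  where
  open ≡-Reasoning
  G = geo (q ^ 3) α
  instance _ = >-nonZero (<-trans (s≤s z≤n) 1<q)
  1<y : 1 < q ^ suc α
  1<y = <-≤-trans 1<q (m≤m*n q (q ^ α) {{m^n≢0 q α}})
  -- `y` and `b` are variables so that matching on `suc` supplies y - 1 as `u` and q³ - 1 as `c`.
  split : ∀ y b → 1 < y → 0 < b → G * b + 1 ≡ G + y ^ 3 →
          (∃[ t ] y ≡ 1 + p * suc t) ⊎ (∃[ r ] quad y ≡ r * p)
  split 1 _ (s≤s ())
  split (suc u@(suc _)) (suc c) _ _ eq
    with euclidsLemma u (quad (suc u)) pp (subst (p ∣_) Gc (∣m⇒∣m*n c p∣G))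
    where
    expandˡ : ∀ G c → (G + 1) + G * c ≡ G * (1 + c) + 1
    expandˡ = solve-∀
    expandʳ : ∀ G u → G + (1 + u) * ((1 + u) * ((1 + u) * 1)) ≡
                      (G + 1) + u * ((1 + u) * (1 + u) + (1 + u) + 1)
    expandʳ = solve-∀
    Gc : G * c ≡ u * quad (suc u)
    Gc = +-cancelˡ-≡ (G + 1) _ _ (trans (expandˡ G c) (trans eq (expandʳ G u)))
  ... | inj₁ (divides (suc t) u≡) = inj₁ (t , cong suc (trans u≡ (*-comm (suc t) p)))
  ... | inj₂ (divides r eq)       = inj₂ (r , eq)

-- Even perfect numbers.

EvenPerfect≢28 : ℕ → Set
EvenPerfect≢28 n = 2 ∣ n × Perfect n × n ≢ 28

6-perfect : EvenPerfect≢28 6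
6-perfect = from-yes (2 ∣? 6) , refl , λ ()

-- Euclid's construction of perfect numbers. For `α = 2` it would give 28; for α ≥ 3 the number is
-- divisible by 8, and 28 is not.
mersenne : ∀ {p α} → Prime p → α ≥ 1 → 1 + p ≡ 2 ^ suc α → p ∣ geo (2 ^ 3) α → EvenPerfect≢28 (p * 2 ^ α)
mersenne {p} {1} pp _ refl _ = 6-perfect
-- 73 = 1 + 8 + 64.
mersenne {p} {2} pp _ refl p∣ = contradiction p∣ (from-no (7 ∣? 73))
mersenne {p} {α@(suc (suc (suc β)))} pp _ p+1 _ =
  ∣n⇒∣m*n p (m∣m*n (2 ^ (2 + β))) , perfect ,
  λ n≡28 → contradiction (subst (8 ∣_) n≡28 (∣n⇒∣m*n p 8∣)) (from-no (8 ∣? 28))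
  where
  8∣ : 8 ∣ 2 ^ α
  8∣ = divides (2 ^ β) (trans (^-distribˡ-+-* 2 3 β) (*-comm 8 (2 ^ β)))
  geo≡p : geo (2 ^ 1) α ≡ p
  geo≡p = +-cancelˡ-≡ (1 + geo 2 α) (geo 2 α) p (begin
    1 + geo 2 α + geo 2 α    ≡⟨ double (geo 2 α) ⟩
    geo 2 α * 2 + 1          ≡⟨ geo-telescope 2 α ⟩
    geo 2 α + 2 ^ suc α      ≡⟨ cong (geo 2 α +_) p+1 ⟨
    geo 2 α + (1 + p)        ≡⟨ shift (geo 2 α) p ⟩
    1 + geo 2 α + p          ∎)
    where
    open ≡-Reasoning
    double : ∀ g → 1 + g + g ≡ g * 2 + 1
    double = solve-∀
    shift : ∀ g p → g + (1 + p) ≡ 1 + g + p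
    shift = solve-∀
  p≢2 : p ≢ 2
  p≢2 refl = contradiction (subst (8 ∣_) (sym p+1) (∣n⇒∣m*n 2 8∣)) (from-no (8 ∣? 3))
  perfect : Perfect (p * 2 ^ α)
  perfect = begin
    σ 1 (p * 2 ^ α)                   ≡⟨ σ-p*q^ pp prime[2] p≢2 α 1 ⟩
    (1 + p ^ 1) * geo (2 ^ 1) α       ≡⟨ cong₂ (λ a b → (1 + a) * b) (*-identityʳ p) geo≡p ⟩
    (1 + p) * p                       ≡⟨ cong (_* p) p+1 ⟩
    2 * 2 ^ α * p                     ≡⟨ shift (2 ^ α) p ⟩
    2 * (p * 2 ^ α)                   ∎
    where
    open ≡-Reasoning
    shift : ∀ z p → 2 * z * p ≡ 2 * (p * z)
    shift = solve-∀

-- If 1 + p is even, so is `q`. Otherwise p = 2, but q^(α+1) ≥ 4.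
1+prime≡^⇒≡2 : ∀ {p q α} → Prime p → Prime q → α ≥ 1 → 1 + p ≡ q ^ suc α → q ≡ 2
1+prime≡^⇒≡2 {p} {q} {α} pp pq α≥1 p+1 with 2∣n⊎2∣1+n p
... | inj₂ 2∣1+p = sym (prime∣prime⇒≡ prime[2] pq (prime∣^⇒∣ (suc α) prime[2] (subst (2 ∣_) p+1 2∣1+p)))
... | inj₁ 2∣p with refl ← prime∣prime⇒≡ prime[2] pp 2∣p = contradiction 4≤3 (from-no (4 ≤? 3))
  where
  open ≤-Reasoning
  4≤3 : 4 ≤ 3
  4≤3 = begin
    2 ^ 2          ≤⟨ ^-monoʳ-≤ 2 (s≤s α≥1) ⟩
    2 ^ suc α      ≤⟨ ^-monoˡ-≤ (suc α) (prime⇒1< pq) ⟩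
    q ^ suc α      ≡⟨ p+1 ⟨
    3              ∎

power-of-2 : ∀ {p q α} → Prime p → Prime q → α ≥ 1 → 1 + p ≡ q ^ suc α → p ∣ geo (q ^ 3) α →
             EvenPerfect≢28 (p * q ^ α)
power-of-2 {α = α} pp pq α≥1 p+1 p∣ with refl ← 1+prime≡^⇒≡2 {α = α} pp pq α≥1 p+1 = mersenne pp α≥1 p+1 p∣

-- The case q ≡ 2 (mod 3) with p ∣ q^(α+1) - 1.

no-1+ : ∀ {p q} → Prime p → Prime q → q % 3 ≡ 2 → q ≢ 1 + p
-- Consecutive primes are 2 and 3, and 3 is not ≡ 2 (mod 3).
no-1+ pp pq q≡2 refl with refl ← consecutive-primes pp pq = case q≡2 of λ ()

-- Used to refute a bound L ≤ R: the ring solver exhibits L as R plus an explicit `m`, absurd when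
-- `m` is a successor.
excess≡0 : ∀ {L R m} → L ≤ R → L ≡ R + m → m ≡ 0
excess≡0 {R = R} {m} L≤R refl = n≤0⇒n≡0 (+-cancelˡ-≤ R m 0 (subst (R + m ≤_) (sym (+-identityʳ R)) L≤R))

k*x⇒0<k : ∀ {p k x} → 1 + p ≡ k * x → 0 < k
k*x⇒0<k {k = suc _} _ = s≤s z≤n

-- `quotient-shape` gives q = k + s p. If s = 0, then 1 + p = q^(α+1). If s ≥ 1, then 1 + p ≤ q ≤ k
-- q^α = 1 + p, making p and q consecutive.
linear-case : ∀ {p k q α t} → Prime p → Prime q → q % 3 ≡ 2 → α ≥ 1 → 1 + p ≡ k * q ^ α →
              p ∣ geo (q ^ 3) α → q ^ suc α ≡ 1 + p * suc t → EvenPerfect≢28 (p * q ^ α)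
linear-case {p} {k} {q} {α} pp pq q≡2 α≥1 p+1 p∣G y≡
  with quotient-shape {Q = q} {{m^n≢0 q α {{prime⇒nonZero pq}}}} p+1 y≡
... | zero , q≡k = power-of-2 pp pq α≥1 (trans p+1 (cong (_* q ^ α) (trans (sym (+-identityʳ k)) (sym q≡k)))) p∣G
... | suc s , q≡k+sp = contradiction q≡1+p (no-1+ pp pq q≡2)
  where
  instance _ = prime⇒nonZero pq
  0<k : 0 < k
  0<k = k*x⇒0<k p+1
  instance _ = >-nonZero 0<k
  q≤1+p : q ≤ 1 + p
  q≤1+p = begin
    q            ≡⟨ *-identityʳ q ⟨
    q ^ 1        ≤⟨ ^-monoʳ-≤ q α≥1 ⟩
    q ^ α        ≤⟨ m≤n*m (q ^ α) k ⟩
    k * q ^ α    ≡⟨ p+1 ⟨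
    1 + p        ∎
    where open ≤-Reasoning
  1+p≤q : 1 + p ≤ q
  1+p≤q = begin
    1 + p              ≤⟨ +-mono-≤ 0<k (m≤m+n p (s * p)) ⟩
    k + (p + s * p)    ≡⟨ q≡k+sp ⟨
    q                  ∎
    where open ≤-Reasoning
  q≡1+p : q ≡ 1 + p
  q≡1+p = ≤-antisym q≤1+p 1+p≤q

-- The case q ≡ 2 (mod 3) with p ∣ y² + y + 1, where y = q^(α+1).

k+s≤1+ks : ∀ {k s} → 0 < k → 0 < s → k + s ≤ 1 + k * s
-- The gap is (k - 1)(s - 1).
k+s≤1+ks {suc a} {suc b} _ _ = subst (suc a + suc b ≤_) (expand a b) (m≤m+n (suc a + suc b) (a * b))
  where
  expand : ∀ a b → (1 + a) + (1 + b) + a * b ≡ 1 + (1 + a) * (1 + b)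
  expand = solve-∀

cofactor-bound : ∀ {q k s c x} → 0 < k → 0 < q → q + k + s ≡ c * x → k * s ≡ q * q + c →
                 c * x ≤ q + (1 + (q * q + c))
cofactor-bound {q} {k} {zero} {c} 0<k 0<q _ ks≡ =
  contradiction (trans (sym (*-zeroʳ k)) ks≡) (<⇒≢ (<-≤-trans (*-mono-≤ 0<q 0<q) (m≤m+n (q * q) c)))
cofactor-bound {q} {k} {s@(suc _)} {c} {x} 0<k 0<q cx ks≡ = begin
  c * x                     ≡⟨ cx ⟨
  q + k + s                 ≡⟨ +-assoc q k s ⟩
  q + (k + s)               ≤⟨ +-monoʳ-≤ q (k+s≤1+ks 0<k (s≤s z≤n)) ⟩
  q + (1 + k * s)           ≡⟨ cong (λ a → q + (1 + a)) ks≡ ⟩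
  q + (1 + (q * q + c))     ∎
  where open ≤-Reasoning

cx⇒0<c : ∀ {q k s c x} → 0 < q → q + k + s ≡ c * x → 0 < c
cx⇒0<c {suc _} {c = suc _} _ _ = s≤s z≤n

-- The excess of c q³ q^β over q² + q + 1 + c, beyond g + d + h, at q = 2 + g, c = 1 + d, q^β = 1 + h.
excess : ℕ → ℕ → ℕ → ℕ
excess g d h = 6 * g + 5 * (g * g) + g * g * g + 6 * d + 7 * h + 8 * (d * h)
              + (12 * g + 6 * (g * g) + g * g * g) * (d + h + d * h)

cube-excess : ∀ g d h → (1 + d) * ((2 + g) * ((2 + g) * ((2 + g) * (1 + h)))) ≡
             ((2 + g) + (1 + ((2 + g) * (2 + g) + (1 + d)))) + ((g + (d + h)) + excess g d h)
cube-excess = expand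
  where
  expand : ∀ g d h → (1 + d) * ((2 + g) * ((2 + g) * ((2 + g) * (1 + h)))) ≡
             ((2 + g) + (1 + ((2 + g) * (2 + g) + (1 + d)))) + ((g + (d + h)) +
             (6 * g + 5 * (g * g) + g * g * g + 6 * d + 7 * h + 8 * (d * h)
              + (12 * g + 6 * (g * g) + g * g * g) * (d + h + d * h)))
  expand = solve-∀

-- By `cube-excess` the left side exceeds the right by at least g + d + h, so the bound forces all
-- three to vanish.
tight : ∀ {q c z} → 1 < q → 0 < c → 0 < z → c * (q * (q * (q * z))) ≤ q + (1 + (q * q + c)) →
        q ≡ 2 × c ≡ 1 × z ≡ 1
tight {1} (s≤s ())
tight {suc (suc g)} {suc d} {suc h} _ _ _ bound =
  zeros g d h (m+n≡0⇒m≡0 (g + (d + h)) (excess≡0 bound (cube-excess g d h)))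
  where
  zeros : ∀ g d h → g + (d + h) ≡ 0 → 2 + g ≡ 2 × 1 + d ≡ 1 × 1 + h ≡ 1
  zeros 0 0 0 _ = refl , refl , refl

-- Arises from q = 2, c = 1, x = 8; `k` and `s` are the roots of X² - 6X + 5.
sum6-product5 : ∀ {k s} → 2 + k + s ≡ 8 → k * s ≡ 5 → k ≡ 1 ⊎ k ≡ 5
sum6-product5 {0} refl ()
sum6-product5 {1} refl _ = inj₁ refl
sum6-product5 {2} refl ()
sum6-product5 {3} refl ()
sum6-product5 {4} refl ()
sum6-product5 {5} refl _ = inj₂ refl
sum6-product5 {6} refl ()

cube-case : ∀ {p k q s c} β → Prime p → Prime q → 0 < k → 1 + p ≡ k * q ^ (3 + β) → p ∣ geo (q ^ 3) (3 + β) →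
            q + k + s ≡ c * q ^ (3 + β) → k * s ≡ q * q + c → ⊥
cube-case {p} {k} {q} {s} {c} β pp pq 0<k p+1 p∣G cx ks =
  excluded (tight 1<q (cx⇒0<c {k = k} {s} {c} {q ^ (3 + β)} 0<q cx) (m^n>0 q {{prime⇒nonZero pq}} β)
      (cofactor-bound {s = s} 0<k 0<q cx ks))
    p+1 p∣G cx ks
  where
  1<q = prime⇒1< pq
  0<q = <-trans (s≤s z≤n) 1<q
  -- p = 8k - 1 is 7 or 39, and 585 = 1 + 8 + 64 + 512.
  7∤585 : 7 ∤ 585
  7∤585 = from-no (7 ∣? 585)
  39-composite : ¬ Prime 39
  39-composite = from-no (prime? 39)
  finish : k ≡ 1 ⊎ k ≡ 5 → 1 + p ≡ k * 8 → p ∣ 585 → ⊥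
  finish (inj₁ refl) refl p∣ = 7∤585 p∣
  finish (inj₂ refl) refl _  = 39-composite pp
  excluded : ∀ {q c} → q ≡ 2 × c ≡ 1 × q ^ β ≡ 1 → 1 + p ≡ k * q ^ (3 + β) → p ∣ geo (q ^ 3) (3 + β) →
             q + k + s ≡ c * q ^ (3 + β) → k * s ≡ q * q + c → ⊥
  excluded (refl , refl , 2^β≡1) p+1 p∣G cx ks with m^n≡1⇒n≡0∨m≡1 2 β 2^β≡1
  ... | inj₁ refl = finish (sum6-product5 {k} {s} cx ks) p+1 p∣G

-- Arises from q = 2, c = 2, x = 4; X² - 6X + 6 has no integer root.
sum6-product6 : ∀ {k s} → 2 + k + s ≡ 8 → k * s ≢ 6
sum6-product6 {0} refl ()
sum6-product6 {1} refl ()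
sum6-product6 {2} refl ()
sum6-product6 {3} refl ()
sum6-product6 {4} refl ()
sum6-product6 {5} refl ()
sum6-product6 {6} refl ()

-- Modulo 3, `k` and `s` would be roots of X² + X + 2, which has none.
sum%3≡product%3≡2 : ∀ k s → (k + s) % 3 ≡ 2 → (k * s) % 3 ≢ 2
sum%3≡product%3≡2 k s +≡2 *≡2 with %3-cases k | %3-cases s
... | inj₁ k≡        | inj₁ s≡        = case trans (sym *≡2) (*-%3 k s k≡ s≡) of λ ()
... | inj₁ k≡        | inj₂ (inj₁ s≡) = case trans (sym *≡2) (*-%3 k s k≡ s≡) of λ ()
... | inj₁ k≡        | inj₂ (inj₂ s≡) = case trans (sym *≡2) (*-%3 k s k≡ s≡) of λ ()
... | inj₂ (inj₁ k≡) | inj₁ s≡        = case trans (sym *≡2) (*-%3 k s k≡ s≡) of λ ()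
... | inj₂ (inj₁ k≡) | inj₂ (inj₁ s≡) = case trans (sym *≡2) (*-%3 k s k≡ s≡) of λ ()
... | inj₂ (inj₁ k≡) | inj₂ (inj₂ s≡) = case trans (sym +≡2) (+-%3 k s k≡ s≡) of λ ()
... | inj₂ (inj₂ k≡) | inj₁ s≡        = case trans (sym *≡2) (*-%3 k s k≡ s≡) of λ ()
... | inj₂ (inj₂ k≡) | inj₂ (inj₁ s≡) = case trans (sym +≡2) (+-%3 k s k≡ s≡) of λ ()
... | inj₂ (inj₂ k≡) | inj₂ (inj₂ s≡) = case trans (sym *≡2) (*-%3 k s k≡ s≡) of λ ()

sum%3 : ∀ {q n} → q % 3 ≡ 2 → q + n ≡ q * q → n % 3 ≡ 2
sum%3 {q} {n} q≡2 eq with %3-cases n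
... | inj₁ n≡        = case trans (sym (+-%3 q n q≡2 n≡)) (trans (cong (_% 3) eq) (*-%3 q q q≡2 q≡2)) of λ ()
... | inj₂ (inj₁ n≡) = case trans (sym (+-%3 q n q≡2 n≡)) (trans (cong (_% 3) eq) (*-%3 q q q≡2 q≡2)) of λ ()
... | inj₂ (inj₂ n≡) = n≡

-- For c = 1, k + s = q² - q and k s = q² + 1 are both ≡ 2 (mod 3). For c ≥ 2, `cofactor-bound`
-- fails unless q = c = 2.
square-case : ∀ {q k s c} → q % 3 ≡ 2 → 1 < q → 0 < k → q + k + s ≡ c * (q * q) → k * s ≡ q * q + c → ⊥
square-case {q} {k} {s} {0} q≡2 1<q 0<k cx ks =
  contradiction (sym cx) (<⇒≢ (<-≤-trans 0<k (≤-trans (m≤n+m k q) (m≤m+n (q + k) s))))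
square-case {q} {k} {s} {1} q≡2 1<q 0<k cx ks = sum%3≡product%3≡2 k s
  (sum%3 {q} q≡2 (trans (sym (+-assoc q k s)) (trans cx (*-identityˡ (q * q)))))
  (trans (cong (_% 3) ks) (+-%3 (q * q) 1 (*-%3 q q q≡2 q≡2) refl))
square-case {1} {c = suc (suc d)} _ (s≤s ()) _ _ _
square-case {2} {k} {s} {2} q≡2 1<q 0<k cx ks = sum6-product6 {k} {s} cx ks
square-case {2} {k} {s} {suc (suc (suc d))} q≡2 1<q 0<k cx ks =
  case excess≡0 (cofactor-bound {2} {k} {s} {3 + d} {4} 0<k (s≤s z≤n) cx ks) (gap d) of λ ()
  where
  gap : ∀ d → (3 + d) * 4 ≡ (2 + (1 + (4 + (3 + d)))) + (2 + 3 * d)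
  gap = solve-∀
square-case {suc (suc (suc g))} {k} {s} {suc (suc d)} q≡2 1<q 0<k cx ks =
  case excess≡0 (cofactor-bound {3 + g} {k} {s} {2 + d} {(3 + g) * (3 + g)} 0<k (s≤s z≤n) cx ks) (gap g d) of λ ()
  where
  gap : ∀ g d → (2 + d) * ((3 + g) * (3 + g)) ≡ ((3 + g) + (1 + ((3 + g) * (3 + g) + (2 + d))))
                 + (3 + (5 * g + g * g + 8 * d + 6 * (d * g) + d * (g * g)))
  gap = solve-∀

-- As k q ≡ 1 (mod p), the divisor p of q² + q k + k² divides (q + k)² - 1.
square-minus-1 : ∀ {p q k s c w} → 1 + p ≡ k * q → q + k + s ≡ c * q → k * s ≡ q * q + c → q + k ≡ 1 + w →
                 w * (2 + w) ≡ (1 + c) * p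
square-minus-1 {p} {q} {k} {s} {c} {w} p+1 cx ks q+k = +-cancelˡ-≡ (1 + c) _ _ (begin
  (1 + c) + w * (2 + w)                     ≡⟨ expand₁ c w ⟩
  c + (1 + w) * (1 + w)                     ≡⟨ cong (λ a → c + a * a) q+k ⟨
  c + (q + k) * (q + k)                     ≡⟨ expand₂ c q k ⟩
  k * q + k * k + (q * q + c) + k * q       ≡⟨ cong (λ a → k * q + k * k + a + k * q) ks ⟨
  k * q + k * k + k * s + k * q             ≡⟨ expand₃ k q s ⟩
  k * (q + k + s) + k * q                   ≡⟨ cong (λ a → k * a + k * q) cx ⟩
  k * (c * q) + k * q                       ≡⟨ expand₄ k c q ⟩
  (1 + c) * (k * q)                         ≡⟨ cong ((1 + c) *_) p+1 ⟨
  (1 + c) * (1 + p)                         ≡⟨ *-suc (1 + c) p ⟩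
  (1 + c) + (1 + c) * p                     ∎)
  where
  open ≡-Reasoning
  expand₁ : ∀ c w → (1 + c) + w * (2 + w) ≡ c + (1 + w) * (1 + w)
  expand₁ = solve-∀
  expand₂ : ∀ c q k → c + (q + k) * (q + k) ≡ k * q + k * k + (q * q + c) + k * q
  expand₂ = solve-∀
  expand₃ : ∀ k q s → k * q + k * k + k * s + k * q ≡ k * (q + k + s) + k * q
  expand₃ = solve-∀
  expand₄ : ∀ k c q → k * (c * q) + k * q ≡ (1 + c) * (k * q)
  expand₄ = solve-∀

-- With w = q + k - 1, the prime `p` divides w (w + 2), so p ≤ w + 2.
kq≤q+k+2 : ∀ {p q k s c} → Prime p → 1 < q → 0 < k → 1 + p ≡ k * q → q + k + s ≡ c * q → k * s ≡ q * q + c →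
           k * q ≤ q + k + 2
kq≤q+k+2 {p} {q} {k@(suc _)} {s} {c} pp 1<q 0<k p+1 cx ks = bound (q + k) refl (+-mono-≤ 1<q 0<k)
  where
  -- 2 < m makes w = m - 1 positive, as bounding a divisor of `w` by `w` requires.
  bound : ∀ m → q + k ≡ m → 2 < m → k * q ≤ q + k + 2
  bound (suc w@(suc _)) q+k _ = begin
    k * q       ≡⟨ p+1 ⟨
    1 + p       ≤⟨ s≤s p≤2+w ⟩
    3 + w       ≡⟨ +-comm 2 (1 + w) ⟩
    1 + w + 2   ≡⟨ cong (_+ 2) q+k ⟨
    q + k + 2   ∎
    where
    open ≤-Reasoning
    p≤2+w : p ≤ 2 + w
    p≤2+w = [ (λ p∣w → ≤-trans (∣⇒≤ p∣w) (m≤n+m w 2)) , ∣⇒≤ ]′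
      (euclidsLemma w (2 + w) pp (divides (1 + c) (square-minus-1 {s = s} p+1 cx ks q+k)))
  bound 1 _ (s≤s ())

-- The bound says (k - 1)(q - 1) ≤ 3. So k = 1, or q = 2 with k ≤ 4; there p = 2k - 1, and only p =
-- 3 divides 9 = 1 + 8.
exponent1-case : ∀ {p q k} → Prime p → Prime q → q % 3 ≡ 2 → p ∣ geo (q ^ 3) 1 → 1 + p ≡ k * q → k * q ≤ q + k + 2 →
                 EvenPerfect≢28 (p * q ^ 1)
exponent1-case {k = 1} pp pq q≡2 _ p+1 _ = contradiction (trans (sym (*-identityˡ _)) (sym p+1)) (no-1+ pp pq q≡2)
exponent1-case {q = 2} {2} pp pq _ p∣ p+1 _ = mersenne {α = 1} pp (s≤s z≤n) p+1 p∣
exponent1-case {q = 2} {3} pp pq _ p∣ refl _ = contradiction p∣ (from-no (5 ∣? 9))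
exponent1-case {q = 2} {4} pp pq _ p∣ refl _ = contradiction p∣ (from-no (7 ∣? 9))
exponent1-case {q = 2} {suc (suc (suc (suc (suc k))))} pp pq _ _ _ kq≤ = case excess≡0 kq≤ (gap k) of λ ()
  where
  gap : ∀ k → (5 + k) * 2 ≡ (2 + (5 + k) + 2) + (1 + k)
  gap = solve-∀
exponent1-case {q = suc (suc (suc (suc (suc g))))} {suc (suc k)} pp pq _ _ _ kq≤ = case excess≡0 kq≤ (gap g k) of λ ()
  where
  gap : ∀ g k → (2 + k) * (5 + g) ≡ ((5 + g) + (2 + k) + 2) + (1 + (4 * k + g + k * g))
  gap = solve-∀

quad-case : ∀ {p k q α r} → Prime p → Prime q → q % 3 ≡ 2 → α ≥ 1 → 1 + p ≡ k * q ^ α →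
            p ∣ geo (q ^ 3) α → quad (q ^ suc α) ≡ r * p → EvenPerfect≢28 (p * q ^ α)
quad-case {p} {k} {q} {α} {r} pp pq q≡2 α≥1 p+1 p∣G eq =
  let s , c , cx , ks = cofactor-shape {r = r} {k = k} {q = q} {{m^n≢0 q α {{prime⇒nonZero pq}}}} p+1 eq
  in cases α s c α≥1 p+1 p∣G cx ks
  where
  1<q = prime⇒1< pq
  0<k = k*x⇒0<k {p} {k} {q ^ α} p+1
  cases : ∀ α s c → α ≥ 1 → 1 + p ≡ k * q ^ α → p ∣ geo (q ^ 3) α → q + k + s ≡ c * q ^ α → k * s ≡ q * q + c →
          EvenPerfect≢28 (p * q ^ α)
  cases 1 s c _ p+1 p∣G cx ks = exponent1-case {k = k} pp pq q≡2 p∣G p+1′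
    (kq≤q+k+2 {s = s} pp 1<q 0<k p+1′ (trans cx (cong (c *_) (*-identityʳ q))) ks)
    where
    p+1′ : 1 + p ≡ k * q
    p+1′ = trans p+1 (cong (k *_) (*-identityʳ q))
  cases 2 s c _ _ _ cx ks =
    ⊥-elim (square-case {s = s} q≡2 1<q 0<k (trans cx (cong (λ a → c * (q * a)) (*-identityʳ q))) ks)
  cases (suc (suc (suc β))) s c _ p+1 p∣G cx ks = ⊥-elim (cube-case {s = s} β pp pq 0<k p+1 p∣G cx ks)

%3≡2-case : ∀ {v q α} → Prime (suc v) → Prime q → q % 3 ≡ 2 → α ≥ 1 → q ^ α ∣ (1 + suc v) * quad v →
            suc v ∣ geo (q ^ 3) α → EvenPerfect≢28 (suc v * q ^ α)
%3≡2-case {v} {q} {α} pp pq q≡2 α≥1 q^α∣ p∣G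
  -- `q` does not divide `quad v`, so all of q^α falls on 1 + p.
  with divides k p+1 ← ∤⇒^∣-cancel α (1 + suc v) pq (≡2mod3⇒∤quad q v q≡2) q^α∣
  with ∣geo³⇒ α pp (prime⇒1< pq) p∣G
... | inj₁ (t , y≡) = linear-case {k = k} {t = t} pp pq q≡2 α≥1 p+1 p∣G y≡
... | inj₂ (r , eq) = quad-case {k = k} {r = r} pp pq q≡2 α≥1 p+1 p∣G eq

-- The case q = 3.

prime[3] : Prime 3
prime[3] = from-yes (prime? 3)

-- For v ≡ 0 or 2 the product is ≡ 2 or 1. With p = 1 + v, the conclusion means p ≡ 2 (mod 3).
∣[2+v]*quad⇒%3≡1 : ∀ v → 3 ∣ (2 + v) * quad v → v % 3 ≡ 1
∣[2+v]*quad⇒%3≡1 v 3∣ with %3-cases v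
... | inj₁ v≡        = case trans (sym (n∣m⇒m%n≡0 _ 3 3∣)) (*-%3 (2 + v) (quad v) (+-%3 2 v refl v≡) (quad-%3 v v≡)) of λ ()
... | inj₂ (inj₁ v≡) = v≡
... | inj₂ (inj₂ v≡) = case trans (sym (n∣m⇒m%n≡0 _ 3 3∣)) (*-%3 (2 + v) (quad v) (+-%3 2 v refl v≡) (quad-%3 v v≡)) of λ ()

-- `quad v` absorbs exactly one factor 3, since its third `w` is ≡ 1.
3^1+a∣⇒3^a∣ : ∀ v a → v % 3 ≡ 1 → 3 ^ suc a ∣ (2 + v) * quad v → 3 ^ a ∣ 2 + v
3^1+a∣⇒3^a∣ v a v≡1 3^∣ = ∤⇒^∣-cancel a (2 + v) prime[3] 3∤w
  (*-cancelˡ-∣ 3 (subst (3 * 3 ^ a ∣_) factor 3^∣))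
  where
  w = 1 + (v / 3 + v / 3 * (v / 3)) * 3
  3∤w : 3 ∤ w
  3∤w 3∣w = prime∤1 prime[3] (∣m+n∣m⇒∣n (subst (3 ∣_) (+-comm 1 _) 3∣w) (n∣m*n (v / 3 + v / 3 * (v / 3))))
  factor : (2 + v) * quad v ≡ 3 * ((2 + v) * w)
  factor = begin
    (2 + v) * quad v                 ≡⟨ cong (λ a → (2 + v) * quad a) (%3≡1⇒ v v≡1) ⟩
    (2 + v) * quad (1 + v / 3 * 3)   ≡⟨ cong ((2 + v) *_) (quad-1+3i (v / 3)) ⟩
    (2 + v) * (w * 3)                ≡⟨ *-assoc (2 + v) w 3 ⟨
    (2 + v) * w * 3                  ≡⟨ *-comm ((2 + v) * w) 3 ⟩
    3 * ((2 + v) * w)                ∎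
    where open ≡-Reasoning

-- With q = 3 and p ≡ 2 (mod 3), only p = 2 and p = 5 satisfy 9 = k + s p with k, s ≥ 1.
small-case : ∀ {p} a k s → Prime p → p % 3 ≡ 2 → 0 < k → 1 + p ≡ k * 3 ^ a → p ∣ geo 27 (suc a) → 9 ≡ k + suc s * p →
             EvenPerfect≢28 (p * 3 ^ suc a)
small-case {2} 0 k s pp p≡2 _ p+1 _ _ = 6-perfect
-- 757 = 1 + 27 + 27².
small-case {2} 1 k s pp p≡2 _ _ p∣ _ = contradiction p∣ (from-no (2 ∣? 757))
small-case {2} (suc (suc a)) k s pp p≡2 _ p+1 _ _ =
  contradiction (subst (9 ∣_) (sym p+1) (∣n⇒∣m*n k (divides (3 ^ a) (trans (^-distribˡ-+-* 3 2 a) (*-comm 9 (3 ^ a)))))) (from-no (9 ∣? 3))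
small-case {5} 0 k s pp p≡2 0<k p+1 _ eq with refl ← trans p+1 (*-identityʳ k) = contradiction eq (<⇒≢ (s≤s (s≤s (s≤s (s≤s (s≤s (s≤s (s≤s (s≤s (s≤s (s≤s z≤n)))))))))))
small-case {5} (suc a) k zero pp p≡2 0<k p+1 _ eq with refl ← +-cancelʳ-≡ 5 4 k eq =
  contradiction (subst (4 ∣_) (sym p+1) (m∣m*n (3 ^ suc a))) (from-no (4 ∣? 6))
small-case {5} (suc a) k (suc s) pp p≡2 0<k p+1 _ eq = contradiction (subst (10 ≤_) (sym eq) (≤-trans (m≤m+n 10 (s * 5)) (m≤n+m (10 + s * 5) k))) (from-no (10 ≤? 9))
small-case {8} a k s pp _ _ _ _ _ = contradiction pp (from-no (prime? 8))
-- p ≥ 9 and k ≥ 1 push the sum to at least 10.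
small-case {p@(suc (suc (suc (suc (suc (suc (suc (suc (suc _))))))))) } a k s pp p≡2 0<k p+1 _ eq =
  contradiction (subst (10 ≤_) (sym eq) (+-mono-≤ 0<k (≤-trans (m≤m+n 9 _) (m≤m+n p (s * p))))) (from-no (10 ≤? 9))

-- As p ≡ 2 (mod 3), it cannot divide `quad y`. In the other branch only x = 3^a is known to divide
-- 1 + p, so y = 9x and `Q = 9`.
q≡3-case : ∀ {v a} → Prime (suc v) → 3 ^ suc a ∣ (2 + v) * quad v → suc v ∣ geo 27 (suc a) →
           EvenPerfect≢28 (suc v * 3 ^ suc a)
q≡3-case {v} {a} pp 3^∣ p∣G = split (3^1+a∣⇒3^a∣ v a v≡1 3^∣) (∣geo³⇒ (suc a) pp (s≤s (s≤s z≤n)) p∣G)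
  where
  v≡1 : v % 3 ≡ 1
  v≡1 = ∣[2+v]*quad⇒%3≡1 v (∣-trans (m∣m*n (3 ^ a)) 3^∣)
  p≡2 : suc v % 3 ≡ 2
  p≡2 = +-%3 1 v refl v≡1
  split : 3 ^ a ∣ 2 + v → (∃[ t ] 3 ^ (2 + a) ≡ 1 + suc v * suc t) ⊎ (∃[ r ] quad (3 ^ (2 + a)) ≡ r * suc v) →
          EvenPerfect≢28 (suc v * 3 ^ suc a)
  split _ (inj₂ (r , eq)) = contradiction (divides r eq) (≡2mod3⇒∤quad (suc v) (3 ^ (2 + a)) p≡2)
  split (divides k p+1) (inj₁ (t , y≡))
    with quotient-shape {k = k} {Q = 9} {t} {{m^n≢0 3 a}} p+1 (trans (*-assoc 3 3 (3 ^ a)) y≡)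
  ... | zero , 9≡k = power-of-2 {α = suc a} pp prime[3] (s≤s z≤n)
          (trans p+1 (trans (cong (_* 3 ^ a) (sym (trans 9≡k (+-identityʳ k)))) (*-assoc 3 3 (3 ^ a)))) p∣G
  ... | suc s , 9≡ = small-case a k s pp p≡2 (k*x⇒0<k p+1) p+1 p∣G 9≡

%3≡0-case : ∀ {v q α} → Prime (suc v) → Prime q → q % 3 ≡ 0 → α ≥ 1 → q ^ α ∣ (2 + v) * quad v →
            suc v ∣ geo (q ^ 3) α → EvenPerfect≢28 (suc v * q ^ α)
%3≡0-case {q = q} {suc a} pp pq q≡0 _ q^α∣ p∣G with refl ← prime∣prime⇒≡ prime[3] pq (m%n≡0⇒n∣m q 3 q≡0) =
  q≡3-case {a = a} pp q^α∣ p∣G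

-- Splitting the hypothesis between p and q^α.

theorem1p7 : (p q α : ℕ) → α ≥ 1 → Prime p → Prime q → p ≢ q → q % 3 ≢ 1 →
    p * q ^ α ∣ σ 3 (p * q ^ α) →
      (2 ∣ p * q ^ α) × Perfect (p * q ^ α) × (p * q ^ α ≢ 28)
theorem1p7 p@(suc v) q α α≥1 pp pq p≢q q≢1 n∣σ = conclude (%3-cases q)
  where
  G = geo (q ^ 3) α
  n∣ : p * q ^ α ∣ (1 + p ^ 3) * G
  n∣ = subst (p * q ^ α ∣_) (σ-p*q^ pp pq p≢q α 3) n∣σ
  p∣G : p ∣ G
  -- 1 + p³ is ≡ 1 modulo `p`.
  p∣G with euclidsLemma (1 + p ^ 3) G pp (∣-trans (m∣m*n (q ^ α)) n∣)
  ... | inj₁ p∣1+p³ = contradiction (∣m+n∣m⇒∣n (subst (p ∣_) (+-comm 1 (p ^ 3)) p∣1+p³) (m∣m*n (p ^ 2))) (prime∤1 pp)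
  ... | inj₂ p∣G    = p∣G
  q^α∣ : q ^ α ∣ (2 + v) * quad v
  -- `G` is ≡ 1 modulo `q`, so q^α must divide 1 + p³.
  q^α∣ = subst (q ^ α ∣_) (1+n³ v)
    (∤⇒^∣-cancel α (1 + p ^ 3) pq (∤geo α pq (m∣m*n (q ^ 2))) (∣-trans (n∣m*n p) n∣))
  conclude : q % 3 ≡ 0 ⊎ q % 3 ≡ 1 ⊎ q % 3 ≡ 2 → EvenPerfect≢28 (p * q ^ α)
  conclude (inj₁ q≡0)        = %3≡0-case pp pq q≡0 α≥1 q^α∣ p∣G
  conclude (inj₂ (inj₁ q≡1)) = contradiction q≡1 q≢1
  conclude (inj₂ (inj₂ q≡2)) = %3≡2-case pp pq q≡2 α≥1 q^α∣ p∣G
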